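{- Every quasi-Sturmian word $\mathbf s$ satisfies $\mathrm{rep}(\mathbf s) \le \sqrt{10} - \frac{3}{2}$.
   Context: For an infinite word $\mathbf x$ over a finite alphabet, $p(n,\mathbf x)$ is the number of distinct factors of length $n$. A quasi-Sturmian word is an infinite word $\mathbf x$ for which there exist integers $k\ge1$ and $n_0$ with $p(n,\mathbf x) = n+k$ for all $n \ge n_0$. With $x_i^j = x_i\cdots x_j$, $r(n,\mathbf x) = \min\{ m \ge 1 : x_i^{i+n-1} = x_{m-n+1}^{m} \text{ for some } i \text{ with } 1 \le i \le m-n\}$, and $\mathrm{rep}(\mathbf x) = \liminf_{n\to+\infty} r(n,\mathbf x)/n$. -}

module Defs where

open import Data.Nat using (ℕ; zero; suc; _+_; _*_; _∸_; _≤_; _<_)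
open import Data.Fin using (Fin; toℕ)
open import Data.Vec using (Vec; lookup)
open import Data.List using (List; length)
open import Data.List.Membership.Propositional using (_∈_)
open import Data.List.Relation.Unary.All using (All)
open import Data.List.Relation.Unary.Unique.Propositional using (Unique)
open import Data.Product using (Σ; ∃; ∃-syntax; _×_)
open import Relation.Binary.PropositionalEquality using (_≡_)
open import Relation.Nullary using (¬_)

-- An infinite word over the finite alphabet Fin d, indexed from 0:
-- (w i) is the letter x_{i+1} of the paper (which indexes from 1).
Word : ℕ → Set
Word d = ℕ → Fin d

IsFactor : ∀ {d n} → Word d → Vec (Fin d) n → Set
IsFactor {n = n} w u = ∃[ i ] ((t : Fin n) → lookup u t ≡ w (i + toℕ t))

HasComplexity : ∀ {d} → Word d → ℕ → ℕ → Set
HasComplexity {d} w n c =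
  Σ (List (Vec (Fin d) n)) λ L →
    (length L ≡ c) × Unique L × All (IsFactor w) L ×
    ((u : Vec (Fin d) n) → IsFactor w u → u ∈ L)

QuasiSturmian : ∀ {d} → Word d → Set
QuasiSturmian w = ∃[ k ] ∃[ n₀ ] ((1 ≤ k) × ((n : ℕ) → n₀ ≤ n → HasComplexity w n (n + k)))

-- RepAt w n m : the condition in the definition of r(n, x) holds for m,
-- i.e. (1-based) x_i^{i+n-1} = x_{m-n+1}^m for some 1 ≤ i ≤ m - n.
-- With 0-based index j = i - 1 this is j + n < m and
-- w (j + t) = w (m - n + t) for all t < n.
RepAt : ∀ {d} → Word d → ℕ → ℕ → Set
RepAt w n m = ∃[ j ] ((j + n < m) × ((t : Fin n) → w (j + toℕ t) ≡ w ((m ∸ n) + toℕ t)))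

IsR : ∀ {d} → Word d → ℕ → ℕ → Set
IsR w n m = (1 ≤ m) × RepAt w n m × ((m' : ℕ) → 1 ≤ m' → m' < m → ¬ RepAt w n m')

-- rep(w) ≤ √10 - 3/2, i.e. liminf r(n,w)/n ≤ √10 - 3/2, expressed as:
-- for every positive rational a/b > √10 - 3/2 (equivalently
-- (2a + 3b)² > 40 b², since a/b + 3/2 > 0) and every N there is n ≥ N
-- with r(n, w)/n < a/b, i.e. b · r(n,w) < a · n.
RepLe√10-3/2 : ∀ {d} → Word d → Set
RepLe√10-3/2 w =
  (a b : ℕ) → 1 ≤ b →
  40 * (b * b) < (2 * a + 3 * b) * (2 * a + 3 * b) →
  (N : ℕ) → ∃[ n ] ∃[ m ] ((N ≤ n) × IsR w n m × (b * m < a * n))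

{-# OPTIONS --safe #-}
module Submission where

-- Let j be the first position where a factor of length n occurs for the second time,
-- at i < j the first time, so that r(n) = j + n. When n grows, (i, j) stays the same
-- until the factor at i is right special; then all factors of length n + 1 occur before
-- the next j, which is therefore J = n + 1 + k. If r(n)/n stays above a/b, consecutive
-- such J have a ratio at most b/(a - b) < 1.52, and uniqueness of special factors
-- together with the recurrence of prefixes forces i to alternate between 0 and a
-- positive value, and the J to evolve by (u, v, S) ↦ (tu + v, u, S + tu + v), a
-- continued fraction step with partial quotient t. The ratio bound leaves only t ∈ {1, 2},
-- then only the period 2, 1, 1, and for that period S / (u + v) tends to 1 / (√10 - 5/2).
-- A prefix that does not recur is removed, which lowers k.

open import Defs
open import Data.Empty using (⊥; ⊥-elim)
open import Data.Fin as Fin using (Fin; zero; suc; toℕ; fromℕ<; punchIn; punchOut)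
import Data.Fin.Properties as Fin
open import Data.List as List using (List; []; _∷_; length)
open import Data.List.Membership.Propositional using (_∈_)
open import Data.List.Membership.Propositional.Properties using (∈-lookup)
open import Data.List.Relation.Unary.All as All using ([]; _∷_)
open import Data.List.Relation.Unary.AllPairs using ([]; _∷_)
import Data.List.Relation.Unary.Any as Any
open import Data.List.Relation.Unary.Any.Properties using (lookup-index)
open import Data.List.Relation.Unary.Unique.Propositional using (Unique)
open import Data.Nat using (ℕ; zero; suc; pred; _+_; _*_; _∸_; _≤_; _<_; z≤n; s≤s; s<s; z<s; >-nonZero)
open import Data.Nat.Properties as ℕ using (+-suc; +-assoc; +-comm; +-identityʳ; ≤-refl; ≤-trans; <-≤-trans; ≤-<-trans; anyUpTo?; m≤n⇒m≤1+n; n<1+n; <⇒≤; m≤n⇒m<n∨m≡n)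
open import Data.Nat.Tactic.RingSolver using (solve-∀)
open import Data.Product using (∃; ∃₂; ∃-syntax; _×_; _,_; proj₁; proj₂)
open import Data.Sum as Sum using (_⊎_; inj₁; inj₂; [_,_]′)
open import Data.Vec as Vec using (Vec; tabulate)
import Data.Vec.Properties as Vec
open import Function using (_∘_; id)
open import Relation.Binary.Definitions using (tri<; tri≈; tri>)
open import Relation.Binary.PropositionalEquality using (_≡_; _≢_; refl; sym; trans; cong; subst; subst₂; module ≡-Reasoning)
open import Relation.Nullary using (¬_; Dec; yes; no; contradiction)
open import Relation.Nullary.Decidable using (map′; _×-dec_)

private variable
  d c m n i j l : ℕ

-- Occurrences of equal factors, and their numbering

record Agree (x : Word d) (n i j : ℕ) : Set where
  constructor agree
  field letters : ∀ {t} → t < n → x (i + t) ≡ x (j + t)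
open Agree

module _ {x : Word d} where

  agree-refl : Agree x n i i
  agree-refl = agree λ _ → refl

  agree-sym : Agree x n i j → Agree x n j i
  agree-sym p = agree λ t<n → sym (letters p t<n)

  agree-trans : Agree x n i j → Agree x n j l → Agree x n i l
  agree-trans p q = agree λ t<n → trans (letters p t<n) (letters q t<n)

  agree-mono : m ≤ n → Agree x n i j → Agree x m i j
  agree-mono m≤n p = agree λ t<m → letters p (<-≤-trans t<m m≤n)

  agree-drop : ∀ δ → Agree x (δ + n) i j → Agree x n (i + δ) (j + δ)
  agree-drop {i = i} {j} δ p = agree λ {t} t<n →
    subst₂ (λ a b → x a ≡ x b) (sym (+-assoc i δ t)) (sym (+-assoc j δ t))
      (letters p (ℕ.+-monoʳ-< δ t<n))

  agree-tail : Agree x (suc n) i j → Agree x n (suc i) (suc j)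
  agree-tail {n} {i} {j} p =
    subst₂ (Agree x n) (+-comm i 1) (+-comm j 1) (agree-drop 1 p)

  agree-snoc : Agree x n i j → x (i + n) ≡ x (j + n) → Agree x (suc n) i j
  agree-snoc {n} {i} {j} p e = agree λ t<1+n → go (m≤n⇒m<n∨m≡n (ℕ.≤-pred t<1+n))
    where
    go : ∀ {t} → t < n ⊎ t ≡ n → x (i + t) ≡ x (j + t)
    go (inj₁ t<n)  = letters p t<n
    go (inj₂ refl) = e

  agree-cons : x i ≡ x j → Agree x n (suc i) (suc j) → Agree x (suc n) i j
  agree-cons {i} {j} {n} e p = agree go
    where
    go : ∀ {t} → t < suc n → x (i + t) ≡ x (j + t)
    go {zero}  _         =
      subst₂ (λ a b → x a ≡ x b) (sym (+-identityʳ i)) (sym (+-identityʳ j)) e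
    go {suc t} (s<s t<n) =
      subst₂ (λ a b → x a ≡ x b) (sym (+-suc i t)) (sym (+-suc j t)) (letters p t<n)

  agree? : ∀ n i j → Dec (Agree x n i j)
  agree? zero    i j = yes (agree λ ())
  agree? (suc n) i j = map′ (λ (p , e) → agree-snoc p e)
    (λ p → agree-mono (ℕ.n≤1+n n) p , letters p (n<1+n n))
    (agree? n i j ×-dec (x (i + n) Fin.≟ x (j + n)))

-- The factors of length n are numbered by Fin c: cls i is the number of the
-- factor at position i, and rep f a position of the factor numbered f.
record Classes (x : Word d) (n c : ℕ) : Set where
  field
    cls       : ℕ → Fin c
    rep       : Fin c → ℕ
    cls-rep   : ∀ f → cls (rep f) ≡ f
    cls⇒agree : cls i ≡ cls j → Agree x n i j
    agree⇒cls : Agree x n i j → cls i ≡ cls j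

  rep-cls : ∀ i → Agree x n (rep (cls i)) i
  rep-cls i = cls⇒agree (cls-rep (cls i))

lookup-injective : ∀ {A : Set} {xs : List A} → Unique xs →
                   ∀ f g → List.lookup xs f ≡ List.lookup xs g → f ≡ g
lookup-injective (_  ∷ _) zero    zero    _ = refl
lookup-injective (∉ ∷ _) zero    (suc g) e = contradiction e (All.lookup ∉ (∈-lookup g))
lookup-injective (∉ ∷ _) (suc f) zero    e = contradiction (sym e) (All.lookup ∉ (∈-lookup f))
lookup-injective (_  ∷ u) (suc f) (suc g) e = cong suc (lookup-injective u f g e)

classes : {x : Word d} → HasComplexity x n c → Classes x n c
classes {n = n} {x = x} (L , refl , unique , sound , complete) = record
  { cls       = cls
  ; rep       = rep
  ; cls-rep   = λ f → lookup-injective unique _ _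
                  (trans (sym (factor-cls (rep f))) (sym (factor-rep f)))
  ; cls⇒agree = λ {i} {j} e → factor⇒agree
                  (trans (factor-cls i) (trans (cong (List.lookup L) e) (sym (factor-cls j))))
  ; agree⇒cls = λ {i} {j} p → lookup-injective unique _ _
                  (trans (sym (factor-cls i)) (trans (agree⇒factor p) (factor-cls j)))
  }
  where
  factor : ℕ → Vec (Fin _) n
  factor i = tabulate (λ t → x (i + toℕ t))

  occurs : ∀ i → factor i ∈ L
  occurs i = complete (factor i) (i , Vec.lookup∘tabulate _)

  cls : ℕ → Fin (length L)
  cls i = Any.index (occurs i)

  factor-cls : ∀ i → factor i ≡ List.lookup L (cls i)
  factor-cls i = lookup-index (occurs i)

  rep : Fin (length L) → ℕ
  rep f = proj₁ (All.lookup sound (∈-lookup f))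

  factor-rep : ∀ f → List.lookup L f ≡ factor (rep f)
  factor-rep f = trans (sym (Vec.tabulate∘lookup _))
    (Vec.tabulate-cong (proj₂ (All.lookup sound (∈-lookup f))))

  agree⇒factor : ∀ {i j} → Agree x n i j → factor i ≡ factor j
  agree⇒factor p = Vec.tabulate-cong (λ t → letters p (Fin.toℕ<n t))

  factor⇒agree : ∀ {i j} → factor i ≡ factor j → Agree x n i j
  factor⇒agree {i} {j} e = agree λ t<n →
    subst (λ s → x (i + s) ≡ x (j + s)) (Fin.toℕ-fromℕ< t<n)
      (trans (sym (Vec.lookup∘tabulate _ (fromℕ< t<n)))
        (trans (cong (λ v → Vec.lookup v (fromℕ< t<n)) e)
          (Vec.lookup∘tabulate _ (fromℕ< t<n))))

-- Special factors when the complexity grows by one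

-- A surjection Fin (1 + c) → Fin c identifies exactly one pair of points.
module Merge (g : Fin (suc c) → Fin c) (h : Fin c → Fin (suc c)) (gh : ∀ y → g (h y) ≡ y) where

  -- `a ≢ h (g a)` says that `a` is outside the image of `h`, which has `c` of the `1 + c` points.
  -- Every pair merged by `g` contains such a point.
  missed-unique : ∀ {a b} → a ≢ h (g a) → b ≢ h (g b) → a ≡ b
  missed-unique {a} {b} a∉ b∉ = go (Fin.pigeonhole (n<1+n _) f)
    where
    f : Fin (suc (suc _)) → Fin (suc _)
    f zero          = a
    f (suc zero)    = b
    f (suc (suc y)) = h y
    go : (∃₂ λ i j → i Fin.< j × f i ≡ f j) → a ≡ b
    go (zero , suc zero , _ , e) = e
    go (zero , suc (suc y) , _ , e) =
      contradiction (trans e (cong h (sym (trans (cong g e) (gh y))))) a∉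
    go (suc zero , suc (suc y) , _ , e) =
      contradiction (trans e (cong h (sym (trans (cong g e) (gh y))))) b∉
    go (suc (suc y) , suc (suc z) , s<s (s<s y<z) , e) =
      contradiction (trans (sym (gh y)) (trans (cong g e) (gh z))) (Fin.<⇒≢ y<z)
    go (suc zero , suc zero , s<s () , _)

  missed : ∀ {a b} → a ≢ b → g a ≡ g b → ∃ λ z → z ≢ h (g z) × g z ≡ g a
  missed {a} {b} a≢b e with a Fin.≟ h (g a)
  ... | no a∉  = a , a∉ , refl
  ... | yes a∈ = b , (λ b∈ → a≢b (trans a∈ (trans (cong h e) (sym b∈)))) , sym e

  merged-unique : ∀ {a b a′ b′} → a ≢ b → g a ≡ g b → a′ ≢ b′ → g a′ ≡ g b′ → g a ≡ g a′
  merged-unique a≢b e a′≢b′ e′ with missed a≢b e | missed a′≢b′ e′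
  ... | z , z∉ , ez | z′ , z′∉ , ez′ =
    trans (sym ez) (trans (cong g (missed-unique z∉ z′∉)) ez′)

  at-most-two : ∀ {a b z} → a ≢ b → g a ≡ g b → g z ≡ g a → z ≡ a ⊎ z ≡ b
  at-most-two {a} {b} {z} a≢b e ez with a Fin.≟ h (g a) | z Fin.≟ h (g z)
  ... | yes a∈ | yes z∈ = inj₁ (trans z∈ (trans (cong h ez) (sym a∈)))
  ... | no  a∉ | no  z∉ = inj₁ (missed-unique z∉ a∉)
  ... | yes a∈ | no  z∉ = inj₂ (missed-unique z∉ λ b∈ → a≢b (trans a∈ (trans (cong h e) (sym b∈))))
  ... | no  a∉ | yes z∈ with b Fin.≟ h (g b)
  ...   | yes b∈ = inj₂ (trans z∈ (trans (cong h (trans ez e)) (sym b∈)))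
  ...   | no  b∉ = contradiction (missed-unique a∉ b∉) a≢b

-- Deleting the last letter is a map `g` as in `Merge`; the one pair it identifies consists of the
-- two extensions of the only right special factor.
module Level {x : Word d} (C : Classes x n c) (C⁺ : Classes x (suc n) (suc c)) where
  private
    module C  = Classes C
    module C⁺ = Classes C⁺

    g : Fin (suc c) → Fin c
    g f = C.cls (C⁺.rep f)
    h : Fin c → Fin (suc c)
    h y = C⁺.cls (C.rep y)
    g-cls : ∀ i → g (C⁺.cls i) ≡ C.cls i
    g-cls i = C.agree⇒cls (agree-mono (ℕ.n≤1+n n) (C⁺.rep-cls i))
    module R = Merge g h (λ y → trans (g-cls (C.rep y)) (C.cls-rep y))
    g-agree : Agree x n i j → g (C⁺.cls i) ≡ g (C⁺.cls j)
    g-agree p = trans (g-cls _) (trans (C.agree⇒cls p) (sym (g-cls _)))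
    cls-break : x (i + n) ≢ x (j + n) → C⁺.cls i ≢ C⁺.cls j
    cls-break ne e = ne (letters (C⁺.cls⇒agree e) (n<1+n n))

  right-special-unique : ∀ {i j i′ j′} →
    Agree x n i j → x (i + n) ≢ x (j + n) →
    Agree x n i′ j′ → x (i′ + n) ≢ x (j′ + n) → Agree x n i i′
  right-special-unique p ne p′ ne′ = C.cls⇒agree (trans (sym (g-cls _)) (trans
    (R.merged-unique (cls-break ne) (g-agree p) (cls-break ne′) (g-agree p′)) (g-cls _)))

  two-right-extensions : ∀ {i j m} →
    Agree x n i j → x (i + n) ≢ x (j + n) → Agree x n m i →
    Agree x (suc n) m i ⊎ Agree x (suc n) m j
  two-right-extensions p ne q =
    Sum.map C⁺.cls⇒agree C⁺.cls⇒agree (R.at-most-two (cls-break ne) (g-agree p) (g-agree q))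

  right-special-exists : ∃₂ λ i j → Agree x n i j × x (i + n) ≢ x (j + n)
  right-special-exists with Fin.pigeonhole (n<1+n c) g
  ... | f , f′ , f<f′ , e = C⁺.rep f , C⁺.rep f′ , C.cls⇒agree e , λ e′ →
    Fin.<⇒≢ f<f′ (trans (sym (C⁺.cls-rep f))
      (trans (C⁺.agree⇒cls (agree-snoc (C.cls⇒agree e) e′)) (C⁺.cls-rep f′)))

  -- Whether the prefix occurs at `suc m` depends only on the factor of length `suc n` at `m`, so
  -- finitely many representatives decide the unbounded search.
  recurs? : Dec (∃ λ m → Agree x n (suc m) 0)
  recurs? = map′ (λ (f , p) → C⁺.rep f , p)
    (λ (m , p) → C⁺.cls m , agree-trans (agree-tail (C⁺.rep-cls m)) p)
    (Fin.any? λ f → agree? n (suc (C⁺.rep f)) 0)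

  -- Deleting the first letter is onto if every factor has an occurrence with a letter before it;
  -- recurrence provides one for the prefix, and `Merge` applies.
  left-special-unique : (∃ λ m → Agree x n (suc m) 0) → ∀ {i j i′ j′} →
    Agree x n (suc i) (suc j) → x i ≢ x j →
    Agree x n (suc i′) (suc j′) → x i′ ≢ x j′ → Agree x n (suc i) (suc i′)
  left-special-unique (m , recurs) p ne p′ ne′ = C.cls⇒agree (trans (sym (g′-cls _)) (trans
    (L.merged-unique (cls-break′ ne) (g′-agree p) (cls-break′ ne′) (g′-agree p′)) (g′-cls _)))
    where
    before : ∀ i → ∃ λ j → Agree x n (suc j) i
    before zero    = m , recurs
    before (suc i) = i , agree-refl
    g′ : Fin (suc c) → Fin c
    g′ f = C.cls (suc (C⁺.rep f))
    h′ : Fin c → Fin (suc c)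
    h′ y = C⁺.cls (proj₁ (before (C.rep y)))
    g′-cls : ∀ i → g′ (C⁺.cls i) ≡ C.cls (suc i)
    g′-cls i = C.agree⇒cls (agree-tail (C⁺.rep-cls i))
    module L = Merge g′ h′ (λ y → trans (g′-cls _)
      (trans (C.agree⇒cls (proj₂ (before (C.rep y)))) (C.cls-rep y)))
    g′-agree : ∀ {i j} → Agree x n (suc i) (suc j) → g′ (C⁺.cls i) ≡ g′ (C⁺.cls j)
    g′-agree p = trans (g′-cls _) (trans (C.agree⇒cls p) (sym (g′-cls _)))
    cls-break′ : ∀ {i j} → x i ≢ x j → C⁺.cls i ≢ C⁺.cls j
    cls-break′ {i} {j} ne e = ne (subst₂ (λ a b → x a ≡ x b) (+-identityʳ i) (+-identityʳ j)
      (letters (C⁺.cls⇒agree e) z<s))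

-- Removing a prefix that does not recur

Recurs : Word d → ℕ → Set
Recurs x n = ∃ λ m → Agree x n (suc m) 0

-- A prefix that occurs at 0 only is the single factor lost with the first letter; `punchOut` closes
-- the gap in the numbering.
classes-shift : {x : Word d} → Classes x n (suc c) → ¬ Recurs x n → Classes (x ∘ suc) n c
classes-shift {n = n} {c = c} {x = x} C ¬recurs = record
  { cls       = cls′
  ; rep       = λ f → proj₁ (position f)
  ; cls-rep   = λ f → trans
      (Fin.punchOut-cong (cls 0) (trans (cong cls (proj₂ (position f))) (cls-rep _)))
      (Fin.punchOut-punchIn (cls 0))
  ; cls⇒agree = λ {i} {j} e → agree (letters (cls⇒agree (Fin.punchOut-injective (≢cls i) (≢cls j) e)))
  ; agree⇒cls = λ {i} {j} p → Fin.punchOut-cong (cls 0) {i≢j = ≢cls i} {i≢k = ≢cls j} (agree⇒cls (agree (letters p)))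
  }
  where
  open Classes C

  ≢cls : ∀ i → cls 0 ≢ cls (suc i)
  ≢cls i e = ¬recurs (i , cls⇒agree (sym e))

  cls′ : ℕ → Fin c
  cls′ i = punchOut (≢cls i)

  position : ∀ f → ∃ λ i → suc i ≡ rep (punchIn (cls 0) f)
  position f with rep (punchIn (cls 0) f) in e
  ... | suc i = i , refl
  ... | zero  = contradiction (trans (sym (cls-rep _)) (cong cls e)) (Fin.punchInᵢ≢i (cls 0) f)

-- A lower bound for the complexity

-- Every suffix of a right special factor is right special, so a right special
-- factor of length n forces at least m + 1 factors of each length m ≤ n.
module _ {x : Word d} (special : Agree x n i j) (break : x (i + n) ≢ x (j + n)) where

  private
    Separated : (m c : ℕ) → Set
    Separated m c = ∃ λ (f : Fin c → ℕ) → ∀ a b → Agree x m (f a) (f b) → a ≡ b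

    separated : ∀ {m} → m ≤ n → Separated m (suc m)
    separated {zero}  _ = (λ _ → 0) , λ { zero zero _ → refl }
    separated {suc m} m<n with separated (<⇒≤ m<n)
    ... | f , inj = add choose
      where
      δ = n ∸ m
      δ+m≡n : δ + m ≡ n
      δ+m≡n = ℕ.m∸n+n≡m (<⇒≤ m<n)
      suffix : Agree x m (i + δ) (j + δ)
      suffix = agree-drop δ (subst (λ n → Agree x n i j) (sym δ+m≡n) special)
      end : ∀ a → a + δ + m ≡ a + n
      end a = trans (+-assoc a δ m) (cong (a +_) δ+m≡n)
      break′ : x (i + δ + m) ≢ x (j + δ + m)
      break′ = subst₂ (λ a b → x a ≢ x b) (sym (end i)) (sym (end j)) break

      New : Set
      New = ∃ λ q → ∀ a → ¬ Agree x (suc m) q (f a)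

      weaken : ∀ {a b} → Agree x (suc m) a b → Agree x m a b
      weaken = agree-mono (ℕ.n≤1+n m)

      -- The suffix has two extensions, and at most one listed position carries the suffix; the
      -- extension not found there is new.
      choose : New
      choose with Fin.any? (λ a → agree? m (i + δ) (f a))
      ... | no ∄a = i + δ , λ a p → ∄a (a , weaken p)
      ... | yes (a , p) with x (i + δ + m) Fin.≟ x (f a + m)
      ...   | yes e = j + δ , λ b q → break′ (trans e (trans
                (cong (λ c → x (f c + m)) (inj a b (agree-trans (agree-sym p) (agree-trans suffix (weaken q)))))
                (sym (letters q (n<1+n m)))))
      ...   | no ne = i + δ , λ b q → ne (trans (letters q (n<1+n m))
                (cong (λ c → x (f c + m)) (inj b a (agree-trans (agree-sym (weaken q)) p))))

      add : New → Separated (suc m) (suc (suc m))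
      add (q , new) = f′ , inj′
        where
        f′ : Fin (suc (suc m)) → ℕ
        f′ zero    = q
        f′ (suc a) = f a
        inj′ : ∀ a b → Agree x (suc m) (f′ a) (f′ b) → a ≡ b
        inj′ zero    zero    p = refl
        inj′ zero    (suc b) p = contradiction p (new b)
        inj′ (suc a) zero    p = contradiction (agree-sym p) (new a)
        inj′ (suc a) (suc b) p = cong suc (inj a b (weaken p))

  complexity-lower-bound : Classes x n c → n < c
  complexity-lower-bound {c} C with n ℕ.<? c
  ... | yes n<c = n<c
  ... | no  n≮c with separated ≤-refl
  ...   | f , inj with Fin.pigeonhole (s≤s (ℕ.≮⇒≥ n≮c)) (λ a → Classes.cls C (f a))
  ...     | a , b , a<b , e = contradiction (inj a b (Classes.cls⇒agree C e)) (Fin.<⇒≢ a<b)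

-- First repetitions and jumps

-- j is the first position where a factor of length n is seen for the second
-- time, and i is its earlier occurrence; in the paper's terms r(n, x) = j + n.
record FirstRep (x : Word d) (n i j : ℕ) : Set where
  field
    i<j      : i < j
    agrees   : Agree x n i j
    distinct : ∀ {a b} → a < j → b < j → Agree x n a b → a ≡ b

module Jumps {x : Word d} {k n₀ : ℕ} (C : ∀ {n} → n₀ ≤ n → Classes x n (n + k)) where

  module Lv {n} (n₀≤n : n₀ ≤ n) = Level (C n₀≤n) (C (m≤n⇒m≤1+n n₀≤n))

  -- The positions 0 to `n + k` outnumber the factors, so a repetition occurs among them.
  first-rep : n₀ ≤ n → ∃₂ λ i j → FirstRep x n i j × j ≤ n + k
  first-rep {n} n₀≤n with scan (suc (n + k))
    where
    scan : ∀ B → (∀ {a b} → a < B → b < B → Agree x n a b → a ≡ b) ⊎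
                 (∃₂ λ i j → FirstRep x n i j × j < B)
    scan zero = inj₁ λ ()
    scan (suc B) with scan B
    ... | inj₂ (i , j , r , j<B) = inj₂ (i , j , r , m≤n⇒m≤1+n j<B)
    ... | inj₁ distinct with anyUpTo? (λ i → agree? n i B) B
    ...   | yes (i , i<B , p) = inj₂ (i , B , record { i<j = i<B ; agrees = p ; distinct = distinct } , n<1+n B)
    ...   | no ∄i = inj₁ λ a<1+B b<1+B p → go (m≤n⇒m<n∨m≡n (ℕ.≤-pred a<1+B)) (m≤n⇒m<n∨m≡n (ℕ.≤-pred b<1+B)) p
      where
      go : ∀ {a b} → a < B ⊎ a ≡ B → b < B ⊎ b ≡ B → Agree x n a b → a ≡ b
      go (inj₁ a<B)  (inj₁ b<B)  p = distinct a<B b<B p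
      go (inj₁ a<B)  (inj₂ refl) p = contradiction (_ , a<B , p) ∄i
      go (inj₂ refl) (inj₁ b<B)  p = contradiction (_ , b<B , agree-sym p) ∄i
      go (inj₂ refl) (inj₂ refl) p = refl
  ... | inj₂ (i , j , r , j<B) = i , j , r , ℕ.≤-pred j<B
  ... | inj₁ distinct with Fin.pigeonhole (n<1+n (n + k)) (λ a → Classes.cls (C n₀≤n) (toℕ a))
  ...   | a , b , a<b , e = contradiction
            (Fin.toℕ-injective (distinct (Fin.toℕ<n a) (Fin.toℕ<n b) (Classes.cls⇒agree (C n₀≤n) e)))
            (Fin.<⇒≢ a<b)

  cover⇒bound : n₀ ≤ n → ∀ {B} → (∀ m → ∃ λ c → c < B × Agree x n c m) → n + k ≤ B
  cover⇒bound {n} n₀≤n {B} cover with n + k ℕ.≤? B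
  ... | yes ≤B = ≤B
  ... | no  ≰B with Fin.pigeonhole (ℕ.≰⇒> ≰B) (λ f → fromℕ< (proj₁ (proj₂ (cover (Classes.rep (C n₀≤n) f)))))
  ...   | f , g , f<g , e = contradiction f≡g (Fin.<⇒≢ f<g)
    where
    open Classes (C n₀≤n)
    at : Fin (n + k) → ℕ
    at f = proj₁ (cover (rep f))
    at≡ : at f ≡ at g
    at≡ = trans (sym (Fin.toℕ-fromℕ< _)) (trans (cong toℕ e) (Fin.toℕ-fromℕ< _))
    f≡g : f ≡ g
    f≡g = trans (sym (cls-rep f)) (trans (agree⇒cls (agree-trans
      (agree-sym (proj₂ (proj₂ (cover (rep f)))))
      (subst (λ c → Agree x n c (rep g)) (sym at≡) (proj₂ (proj₂ (cover (rep g))))))) (cls-rep g))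

  -- A length whose first repetition comes as late as possible: the positions before `n + k` show
  -- every factor exactly once.
  record Jump (n i : ℕ) : Set where
    field
      level : n₀ ≤ n
      first : FirstRep x n i (n + k)
      cover : ∀ m → ∃ λ c → c < n + k × Agree x n c m
    open FirstRep first public

  -- In the Rauzy graph of order n the path reaches the only branching vertex
  -- for the second time at j and leaves it by the second edge; when an edge is
  -- repeated for the first time, every edge has been used.
  jump : n₀ ≤ n → FirstRep x n i j → x (i + n) ≢ x (j + n) → ∃ λ i′ → Jump (suc n) i′
  jump {n} {i} {j} n₀≤n r break with first-rep (m≤n⇒m≤1+n n₀≤n)
  ... | i′ , j′ , r′ , j′≤ = i′ , record
      { level = m≤n⇒m≤1+n n₀≤n
      ; first = subst (FirstRep x (suc n) i′) j′≡ r′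
      ; cover = λ m → subst (λ J → ∃ λ c → c < J × Agree x (suc n) c m) j′≡ (cover m)
      }
    where
    module r  = FirstRep r
    module r′ = FirstRep r′
    weaken : ∀ {a b} → Agree x (suc n) a b → Agree x n a b
    weaken = agree-mono (ℕ.n≤1+n n)

    j<j′ : j < j′
    j<j′ with ℕ.<-cmp j j′
    ... | tri< j<j′ _ _ = j<j′
    ... | tri> _ _ j′<j = contradiction
            (r.distinct (ℕ.<-trans r′.i<j j′<j) j′<j (weaken r′.agrees)) (ℕ.<⇒≢ r′.i<j)
    ... | tri≈ _ refl _ = contradiction
            (subst (λ a → x (a + n) ≡ x (j + n))
              (r.distinct r′.i<j r.i<j (agree-trans (weaken r′.agrees) (agree-sym r.agrees)))
              (letters r′.agrees (n<1+n n)))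
            break

    -- Follow `x` from 0, keeping an equal edge before `j′`. A vertex at `j′` is replaced by `i′`; a
    -- wrong next letter reveals the branching vertex, whose two edges occur at `i` and `j`.
    cover : ∀ m → ∃ λ c → c < j′ × Agree x (suc n) c m
    cover zero    = 0 , ≤-<-trans z≤n j<j′ , agree-refl
    cover (suc m) with cover m
    ... | c , c<j′ , p = edge (vertex (m≤n⇒m<n∨m≡n c<j′))
      where
      Vertex : Set
      Vertex = ∃ λ c → c < j′ × Agree x n c (suc m)
      vertex : suc c < j′ ⊎ suc c ≡ j′ → Vertex
      vertex (inj₁ 1+c<j′) = suc c , 1+c<j′ , agree-tail p
      vertex (inj₂ refl)   = i′ , r′.i<j , agree-trans (weaken r′.agrees) (agree-tail p)
      edge : Vertex → ∃ λ c → c < j′ × Agree x (suc n) c (suc m)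
      edge (c , c<j′ , p) with x (c + n) Fin.≟ x (suc m + n)
      ... | yes e = c , c<j′ , agree-snoc p e
      ... | no ne with Lv.two-right-extensions n₀≤n r.agrees break
                         (agree-trans (agree-sym p) (Lv.right-special-unique n₀≤n p ne r.agrees break))
      ...   | inj₁ q = i , ℕ.<-trans r.i<j j<j′ , agree-sym q
      ...   | inj₂ q = j , j<j′ , agree-sym q

    j′≡ : j′ ≡ suc n + k
    j′≡ = ℕ.≤-antisym j′≤ (cover⇒bound (m≤n⇒m≤1+n n₀≤n) cover)

  break-point : ∀ f → Agree x n i j →
    Agree x (f + n) i j ⊎ (∃ λ N → n ≤ N × Agree x N i j × x (i + N) ≢ x (j + N))
  break-point zero p = inj₁ p
  break-point {n} {i} {j} (suc f) p with break-point f p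
  ... | inj₂ b = inj₂ b
  ... | inj₁ q with x (i + (f + n)) Fin.≟ x (j + (f + n))
  ...   | yes e = inj₁ (agree-snoc q e)
  ...   | no ne = inj₂ (f + n , ℕ.m≤n+m n f , q , ne)

  -- Consecutive jumps: the repetition stops extending at length `N`, so the factor of that length
  -- at `i` is right special.
  record Link (n i N i′ : ℕ) : Set where
    field
      source : Jump n i
      target : Jump (suc N) i′
      n≤N    : n ≤ N
      agrees : Agree x N i (n + k)
      break  : x (i + N) ≢ x (n + k + N)
    module S = Jump source
    module T = Jump target

    n₀≤N : n₀ ≤ N
    n₀≤N = ≤-trans S.level n≤N

    J<J′ : n + k < suc N + k
    J<J′ = ℕ.+-monoˡ-< k (s≤s n≤N)

    i<J′ : i < suc N + k
    i<J′ = ℕ.<-trans S.i<j J<J′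

    -- Each of the two extensions occurs only once before the next jump.
    occurrences : ∀ {c} → c < suc N + k → Agree x N c i → c ≡ i ⊎ c ≡ n + k
    occurrences c<J′ p with Lv.two-right-extensions n₀≤N agrees break p
    ... | inj₁ q = inj₁ (T.distinct c<J′ i<J′ q)
    ... | inj₂ q = inj₂ (T.distinct c<J′ J<J′ q)

    -- With i > 0 the prefix is not the branching vertex, so its incoming edge
    -- can only be the last one found.
    returns-to-start : 0 < i → Recurs x N → i′ ≡ 0
    returns-to-start 0<i (m , recurs) with T.cover m
    ... | c , c<J′ , p = go (m≤n⇒m<n∨m≡n c<J′)
      where
      at-start : Agree x N (suc c) 0
      at-start = agree-trans (agree-tail p) recurs
      not-special : ¬ Agree x N 0 i
      not-special q with occurrences (≤-<-trans z≤n J<J′) q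
      ... | inj₁ 0≡i = ℕ.<⇒≢ 0<i 0≡i
      ... | inj₂ 0≡J = ℕ.<⇒≢ (≤-<-trans z≤n S.i<j) 0≡J
      extends : Agree x (suc N) (suc c) 0
      extends with x (suc c + N) Fin.≟ x N
      ... | yes e = agree-snoc at-start e
      ... | no ne = contradiction
              (agree-trans (agree-sym at-start) (Lv.right-special-unique n₀≤N at-start ne agrees break))
              not-special
      go : suc c < suc N + k ⊎ suc c ≡ suc N + k → i′ ≡ 0
      go (inj₁ <J′) = contradiction (T.distinct <J′ (≤-<-trans z≤n J<J′) extends) λ ()
      go (inj₂ ≡J′) = T.distinct T.i<j (≤-<-trans z≤n J<J′)
        (agree-trans T.agrees (subst (λ c → Agree x (suc N) c 0) ≡J′ extends))

  -- Equal preceding letters would give a repetition one position before the first one.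
  left-special : Jump n (suc l) → ∃ λ J → suc J ≡ n + k × Agree x n (suc l) (suc J) × x l ≢ x J
  left-special {n} {l} s = go (n + k) refl
    where
    module s = Jump s
    go : ∀ J → J ≡ n + k → ∃ λ J → suc J ≡ n + k × Agree x n (suc l) (suc J) × x l ≢ x J
    go zero    e = contradiction (subst (suc l <_) (sym e) s.i<j) λ ()
    go (suc J) e = J , e , p , λ xl≡xJ → ℕ.<⇒≢ (ℕ.≤-pred l<J) (s.distinct
        (subst (l <_) e (m≤n⇒m≤1+n (ℕ.≤-pred l<J))) (subst (J <_) e (n<1+n J))
        (agree-mono (ℕ.n≤1+n n) (agree-cons xl≡xJ p)))
      where
      l<J : suc l < suc J
      l<J = subst (suc l <_) (sym e) s.i<j
      p : Agree x n (suc l) (suc J)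
      p = subst (Agree x n (suc l)) (sym e) s.agrees

  -- The right special factor of order N′, at i′, ends with the one of order N.
  special-suffix : ∀ {N i′ N′ i″} → Link n i N i′ → Link (suc N) i′ N′ i″ →
    ∃ λ δ → N′ ≡ suc δ + N × Agree x N (i′ + suc δ) i
  special-suffix {n} {i} {N} {i′} {N′} A B = δ , N′≡ , Lv.right-special-unique A.n₀≤N
      (agree-drop (suc δ) (subst (λ N → Agree x N i′ _) N′≡ B.agrees))
      (subst₂ (λ a b → x a ≢ x b) (end i′) (end _) B.break) A.agrees A.break
    where
    module A = Link A
    module B = Link B
    δ = N′ ∸ suc N
    N′≡ : N′ ≡ suc δ + N
    N′≡ = trans (sym (ℕ.m∸n+n≡m B.n≤N)) (+-suc δ N)
    end : ∀ a → a + N′ ≡ a + suc δ + N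
    end a = trans (cong (a +_) N′≡) (sym (+-assoc a (suc δ) N))

-- Tools for inequalities

-- Inequalities are derived by adding up hypotheses to L ≤ R and exhibiting the
-- slack s of the conclusion in a semiring identity.
derive : ∀ {L R X Y} s → L ≤ R → X + R + s ≡ Y + L → X ≤ Y
derive {L} {R} {X} {Y} s L≤R e = ℕ.+-cancelʳ-≤ R X Y
  (≤-trans (ℕ.m≤m+n (X + R) s) (≤-trans (ℕ.≤-reflexive e) (ℕ.+-monoʳ-≤ Y L≤R)))

refute : ∀ {a b z} → a ≤ b → a ≡ b + z → 1 ≤ z → ⊥
refute {b = b} a≤b refl 1≤z = ℕ.<⇒≱ (ℕ.m<m+n b 1≤z) a≤b

infixr 6 _⊕_
infixr 7 _⊗_
_⊕_ : ∀ {a b c e} → a ≤ b → c ≤ e → a + c ≤ b + e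
_⊕_ = ℕ.+-mono-≤

_⊗_ : ∀ m {a b} → a ≤ b → m * a ≤ m * b
_⊗_ m = ℕ.*-monoʳ-≤ m

-- Offsets and positions of successive jumps

module Dynamics {x : Word d} {k n₀ : ℕ} (C : ∀ {n} → n₀ ≤ n → Classes x n (n + k))
  -- `D` is the goal, reached once a repetition is short enough; until then all repetitions obey the
  -- bound in `long`.
  (D : Set) (P Q : ℕ) (0<P : 0 < P)
  (long : ∀ {n i j} → n₀ ≤ n → i < j → Agree x n i j → D ⊎ P * (suc n + k) ≤ Q * j)
  (recurs : ∀ {n} → n₀ ≤ n → D ⊎ Recurs x n)
  (ratio : ∀ {X Y} → P * X ≤ Q * Y → 33 * X ≤ 50 * Y)
  where

  open Jumps C

  private
    _>>=_ : ∀ {A B : Set} → D ⊎ A → (A → D ⊎ B) → D ⊎ B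
    inj₁ done >>= _ = inj₁ done
    inj₂ a    >>= f = f a

  record Near (n i N i′ : ℕ) : Set where
    field
      link  : Link n i N i′
      bound : P * (suc N + k) ≤ Q * (n + k)
    open Link link public

  next-jump : n₀ ≤ n → FirstRep x n i j → D ⊎ (∃₂ λ N i′ →
    n ≤ N × Agree x N i j × x (i + N) ≢ x (j + N) × Jump (suc N) i′ × P * (suc N + k) ≤ Q * j)
  -- `Q * j` further letters suffice: agreement on all of them would violate the bound in `long`.
  next-jump {n} {i} {j} n₀≤n r with break-point (Q * j) r.agrees
    where module r = FirstRep r
  ... | inj₁ p = long (≤-trans n₀≤n (ℕ.m≤n+m n (Q * j))) (FirstRep.i<j r) p >>= λ small →
    ⊥-elim (ℕ.<⇒≱ (too-long 0<P) small)
    where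
    too-long : ∀ {P} → 0 < P → Q * j < P * (suc (Q * j + n) + k)
    too-long {suc P} _ = ℕ.m≤n⇒m≤n+o _ (s≤s (≤-trans (ℕ.m≤m+n (Q * j) n) (ℕ.m≤m+n _ k)))
  ... | inj₂ (N , n≤N , p , ne) =
    let n₀≤N = ≤-trans n₀≤n n≤N
        i′ , t = jump n₀≤N (record { i<j = FirstRep.i<j r ; agrees = p
                   ; distinct = λ a<j b<j q → FirstRep.distinct r a<j b<j (agree-mono n≤N q) }) ne
    in long n₀≤N (FirstRep.i<j r) p >>= λ small → inj₂ (N , i′ , n≤N , p , ne , t , small)

  next : Jump n i → D ⊎ (∃₂ λ N i′ → Near n i N i′)
  next s = next-jump (Jump.level s) (Jump.first s) >>= λ (N , i′ , n≤N , p , ne , t , small) →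
    inj₂ (N , i′ , record
      { link = record { source = s ; target = t ; n≤N = n≤N ; agrees = p ; break = ne } ; bound = small })

  -- The ratio 50/33 lies below the golden ratio, so jump positions grow more slowly than by the
  -- Fibonacci recursion.
  growth-bound : ∀ {N i′ N′ i″} → Near n i N i′ → Near (suc N) i′ N′ i″ →
                 ¬ (n + k) + (suc N + k) ≤ suc N′ + k
  growth-bound {n} {i} {N} {N′ = N′} A B le =
    refute (33 ⊗ ratio (Near.bound A) ⊕ 50 ⊗ ratio (Near.bound B) ⊕ 1650 ⊗ le)
      (identity (n + k) (suc N + k) (suc N′ + k)) (s≤s z≤n)
    where
    identity : ∀ J₀ J₁ J₂ → 33 * (33 * J₁) + (50 * (33 * J₂) + 1650 * (J₀ + J₁))
      ≡ 33 * (50 * J₀) + (50 * (50 * J₁) + 1650 * J₂) + 239 * J₁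
    identity = solve-∀

  -- The special factor of order `N` ends the next one and so occurs at `suc δ`, which is positive
  -- and hence at least `n + k`. The third jump position is then at least the sum of the first two.
  not-twice-at-start : ∀ {N N′ i″} → Near n 0 N 0 → Near (suc N) 0 N′ i″ → ⊥
  not-twice-at-start {n} {N} {N′} A B with special-suffix (Near.link A) (Near.link B)
  ... | δ , refl , p = growth-bound A B
      (ℕ.≤-trans (ℕ.+-monoˡ-≤ (suc N + k) J≤) (ℕ.≤-reflexive (regroup δ N k)))
    where
    regroup : ∀ δ N k → suc δ + (suc N + k) ≡ suc (suc δ + N) + k
    regroup = solve-∀
    J≤ : n + k ≤ suc δ
    J≤ with suc δ ℕ.<? suc N + k
    ... | no  ≮J′ = ≤-trans (<⇒≤ (Near.J<J′ A)) (ℕ.≮⇒≥ ≮J′)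
    ... | yes <J′ with Near.occurrences A <J′ p
    ...   | inj₂ e = ℕ.≤-reflexive (sym e)

  -- Before suc N + k the right special factor of order N occurs at 0 and n + k only; going
  -- back along the run of period β that starts at l leads from its later occurrence to n + k.
  jump-length : ∀ {N l N′ i″ β} → Near n 0 N l → Near (suc N) l N′ i″ → 0 < l → β + l ≡ suc N + k →
                ∃ λ t → suc N′ + k ≡ (n + k) + suc t * β
  jump-length {n} {N} {l} {N′} {i″} {β} A B 0<l β+l≡J′ with special-suffix (Near.link A) (Near.link B)
  ... | δ , refl , p with descend (l + suc δ) ≤-refl (ℕ.<-≤-trans 0<l (ℕ.m≤m+n l (suc δ))) ≤-refl p
    where
    0<β : 0 < β
    0<β = ℕ.+-cancelʳ-< l 0 β (subst (l <_) (sym β+l≡J′) (Near.S.i<j B))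
    descend : ∀ f {q} → q ≤ f → 0 < q → q ≤ l + suc δ → Agree x N q 0 → ∃ λ t → q ≡ (n + k) + t * β
    descend zero    {suc q} () _ _ _
    descend (suc f) {q} q≤f 0<q q≤ p with q ℕ.<? suc N + k
    ... | yes q<J′ with Near.occurrences A q<J′ p
    ...   | inj₁ refl = contradiction 0<q λ ()
    ...   | inj₂ refl = 0 , sym (+-identityʳ _)
    descend (suc f) {q} q≤f 0<q q≤ p | no q≮J′ =
      let t , e = descend f (ℕ.≤-pred (<-≤-trans q′<q q≤f))
                    (<-≤-trans 0<l (ℕ.m≤m+n l y)) (≤-trans (<⇒≤ q′<q) q≤)
                    (agree-trans (agree-drop y (agree-mono (ℕ.+-monoˡ-≤ N y≤) (Near.agrees B)))
                      (subst (λ q → Agree x N q 0) (sym (trans (+-comm _ y) y+J′≡q)) p))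
      in suc t , trans (sym y+J′≡q) (trans (cong (y +_) (sym β+l≡J′))
                   (trans (rearrange y β l) (trans (cong (_+ β) e) (rearrange′ (n + k) (t * β) β))))
      where
      y = q ∸ (suc N + k)
      y+J′≡q : y + (suc N + k) ≡ q
      y+J′≡q = ℕ.m∸n+n≡m (ℕ.≮⇒≥ q≮J′)
      rearrange : ∀ y β l → y + (β + l) ≡ l + y + β
      rearrange = solve-∀
      rearrange′ : ∀ J a β → J + a + β ≡ J + (β + a)
      rearrange′ = solve-∀
      q≡ : l + y + β ≡ q
      q≡ = trans (sym (rearrange y β l)) (trans (cong (y +_) β+l≡J′) y+J′≡q)
      q′<q : l + y < q
      q′<q = subst (l + y <_) q≡ (ℕ.m<m+n (l + y) 0<β)
      y≤ : y ≤ suc δ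
      y≤ = ℕ.+-cancelˡ-≤ l y (suc δ) (≤-trans (<⇒≤ q′<q) q≤)
  ... | t , e = t , (begin
      suc (suc δ + N) + k     ≡⟨ regroup δ N k ⟩
      suc δ + (suc N + k)     ≡⟨ cong (suc δ +_) (sym β+l≡J′) ⟩
      suc δ + (β + l)         ≡⟨ regroup′ (suc δ) β l ⟩
      β + (l + suc δ)         ≡⟨ cong (β +_) e ⟩
      β + (n + k + t * β)     ≡⟨ regroup″ β (n + k) (t * β) ⟩
      (n + k) + suc t * β     ∎)
    where
    open ≡-Reasoning
    regroup : ∀ δ N k → suc (suc δ + N) + k ≡ suc δ + (suc N + k)
    regroup = solve-∀
    regroup′ : ∀ d β l → d + (β + l) ≡ β + (l + d)
    regroup′ = solve-∀
    regroup″ : ∀ β J a → β + (J + a) ≡ J + (β + a)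
    regroup″ = solve-∀

  -- The special factor of order `N` ends that of order `N₂`, so it occurs at N₂ - N. By
  -- `growth-bound` this is before `n + k`, which leaves only `l`.
  jump-by-offset : ∀ {l N N₂ i₃} → Near n l N 0 → Near (suc N) 0 N₂ i₃ → N₂ ≡ l + N
  jump-by-offset {n} {l} {N} A B with special-suffix (Near.link A) (Near.link B)
  ... | δ , refl , p = go (suc δ ℕ.<? suc N + k)
    where
    regroup : ∀ δ N k → suc δ + (suc N + k) ≡ suc (suc δ + N) + k
    regroup = solve-∀
    large : n + k ≤ suc δ → ⊥
    large le = growth-bound A B (≤-trans (ℕ.+-monoˡ-≤ (suc N + k) le) (ℕ.≤-reflexive (regroup δ N k)))
    go : Dec (suc δ < suc N + k) → suc δ + N ≡ l + N
    go (no ≮J′) = ⊥-elim (large (≤-trans (<⇒≤ (Near.J<J′ A)) (ℕ.≮⇒≥ ≮J′)))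
    go (yes <J′) with Near.occurrences A <J′ p
    ... | inj₁ e = cong (_+ N) e
    ... | inj₂ e = ⊥-elim (large (ℕ.≤-reflexive (sym e)))

  -- Both suc l and suc l′ are occurrences of the left special factor of order N,
  -- and suc l′ ≢ suc l because the letter at suc N₂ + k - 1 repeats the one at l.
  next-offset : ∀ {l N N₂ l′} → Near n (suc l) N 0 → Near (suc N) 0 N₂ (suc l′) →
                Recurs x N → suc l′ ≡ n + k
  next-offset {n} {l} {N} {N₂} {l′} A B recurs
    with jump-by-offset A B | left-special (Near.source A) | left-special (Near.target B)
  ... | refl | J , 1+J≡ , _ , ne | J′ , 1+J′≡ , p′ , ne′ = go (suc l′ ℕ.<? suc N + k)
    where
    N≤ : N ≤ suc (suc l + N)
    N≤ = m≤n⇒m≤1+n (ℕ.m≤n+m N (suc l))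
    same : Agree x N (suc l′) (suc l)
    same = Lv.left-special-unique (Near.n₀≤N A) recurs (agree-mono N≤ p′) ne′
      (subst (Agree x N (suc l)) (sym 1+J≡) (Near.agrees A)) ne
    regroup : ∀ l N k → l + (suc N + k) ≡ suc l + N + k
    regroup = solve-∀
    regroup′ : ∀ l N k → suc l + (suc N + k) ≡ suc (suc l + N) + k
    regroup′ = solve-∀
    l′≢l : l′ ≢ l
    l′≢l refl = ne′ (trans (letters (Near.agrees B) (s≤s (ℕ.m≤m+n l N)))
      (cong x (trans (+-comm _ l) (trans (regroup l N k) (ℕ.suc-injective (sym 1+J′≡))))))
    go : Dec (suc l′ < suc N + k) → suc l′ ≡ n + k
    go (yes <J′) with Near.occurrences A <J′ same
    ... | inj₁ e = contradiction (ℕ.suc-injective e) l′≢l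
    ... | inj₂ e = e
    go (no ≮J′) = ⊥-elim ([ ℕ.<⇒≢ y<1+l , ℕ.<⇒≢ (ℕ.<-trans y<1+l (Near.S.i<j A)) ]′
        (Near.occurrences A (ℕ.<-trans y<1+l (Near.i<J′ A))
          (agree-trans (agree-drop y (agree-mono (ℕ.+-monoˡ-≤ N (<⇒≤ y<1+l)) (Near.agrees B)))
            (subst (λ q → Agree x N q (suc l)) (sym (trans (+-comm _ y) y+J′≡)) same))))
      where
      y = suc l′ ∸ (suc N + k)
      y+J′≡ : y + (suc N + k) ≡ suc l′
      y+J′≡ = ℕ.m∸n+n≡m (ℕ.≮⇒≥ ≮J′)
      y<1+l : y < suc l
      y<1+l = ℕ.+-cancelʳ-< (suc N + k) y (suc l)
        (subst₂ _<_ (sym y+J′≡) (sym (regroup′ l N k)) (Near.T.i<j B))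

  -- For consecutive jump positions J₀ < J₁ with offsets 0 and suc l:
  -- S = J₁, u = J₁ - suc l, and v = J₀ - u.
  record State (u v S : ℕ) : Set where
    field
      {n₁ N₁ l₁} : ℕ
      near    : Near n₁ 0 N₁ (suc l₁)
      u+l     : u + suc l₁ ≡ suc N₁ + k
      u+v     : u + v ≡ n₁ + k
      S≡      : S ≡ suc N₁ + k
      0<v     : 0 < v

    0<u : 0 < u
    0<u = ℕ.+-cancelʳ-< (suc l₁) 0 u (subst (suc l₁ <_) (sym u+l) (Near.T.i<j near))

    S-bound : P * S ≤ Q * (u + v)
    S-bound = subst₂ (λ a b → P * a ≤ Q * b) (sym S≡) (sym u+v) (Near.bound near)

  -- The offsets are 0, `suc l`, 0, `suc l′` at jumps J₀, J₁, J₂, J₃. Here J₂ = J₀ + (t + 1)u, J₃ =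
  -- J₂ + `suc l` and `suc l′` = J₁, so the new u is J₃ - J₁ = J₀ + tu.
  advance : ∀ {l N u} → Near n 0 N (suc l) → u + suc l ≡ suc N + k → D ⊎ (∃ λ t →
    State ((n + k) + t * u) u (suc N + k + ((n + k) + t * u)) ×
    P * ((n + k) + suc t * u) ≤ Q * (suc N + k))
  advance {n} {l} {N} {u} A u+l =
    next (Near.target A) >>= λ (N₂ , i₂ , B) →
    recurs (Near.n₀≤N B) >>= λ rec →
    continue B rec (Near.returns-to-start B (s≤s z≤n) rec)
    where
    0<u : 0 < u
    0<u = ℕ.+-cancelʳ-< (suc l) 0 u (subst (suc l <_) (sym u+l) (Near.T.i<j A))
    Goal : Set
    Goal = D ⊎ (∃ λ t →
      State ((n + k) + t * u) u (suc N + k + ((n + k) + t * u)) ×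
      P * ((n + k) + suc t * u) ≤ Q * (suc N + k))
    finish : ∀ {N₂ N₃ l′} → Near (suc N) (suc l) N₂ 0 → Near (suc N₂) 0 N₃ (suc l′) →
             N₃ ≡ suc l + N₂ → suc l′ ≡ suc N + k → Goal
    finish {N₂} {_} {l′} B E refl l′≡ with jump-length A B (s≤s z≤n) u+l
    ... | t , J₂≡ = inj₂ (t , record
        { near = E
        ; u+l  = trans (cong ((n + k) + t * u +_) l′≡) J₃≡
        ; u+v  = trans (swap (n + k) (t * u) u) (sym J₂≡)
        ; S≡   = trans (+-comm (suc N + k) _) J₃≡
        ; 0<v  = 0<u
        } , subst (λ J → P * J ≤ Q * (suc N + k)) J₂≡ (Near.bound B))
      where
      open ≡-Reasoning
      swap : ∀ J a u → J + a + u ≡ J + (u + a)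
      swap = solve-∀
      regroup : ∀ l N k → suc l + (suc N + k) ≡ suc (suc l + N) + k
      regroup = solve-∀
      mix : ∀ J a u l → J + a + (u + l) ≡ l + (J + (u + a))
      mix = solve-∀
      J₃≡ : (n + k) + t * u + (suc N + k) ≡ suc (suc l + N₂) + k
      J₃≡ = begin
        (n + k) + t * u + (suc N + k)     ≡⟨ cong ((n + k) + t * u +_) (sym u+l) ⟩
        (n + k) + t * u + (u + suc l)     ≡⟨ mix (n + k) (t * u) u (suc l) ⟩
        suc l + ((n + k) + suc t * u)     ≡⟨ cong (suc l +_) (sym J₂≡) ⟩
        suc l + (suc N₂ + k)              ≡⟨ regroup l N₂ k ⟩
        suc (suc l + N₂) + k              ∎
    continue : ∀ {N₂ i₂} → Near (suc N) (suc l) N₂ i₂ → Recurs x N₂ → i₂ ≡ 0 → Goal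
    continue B rec refl = next (Near.target B) >>= λ where
      (N₃ , zero   , E) → next (Near.target E) >>= λ (_ , _ , F) → ⊥-elim (not-twice-at-start E F)
      (N₃ , suc l′ , E) → finish B E (jump-by-offset B E) (next-offset B E rec)

  -- With J₀ = u + v the partial quotient is `suc t`. The last component is the ratio bound for the
  -- link between the two states.
  step : ∀ {u v S} → State u v S → D ⊎ (∃ λ t →
    State (suc t * u + v) u (S + (suc t * u + v)) × P * ((suc t * u + v) + u) ≤ Q * S)
  step {u} {v} {S} s = advance near u+l >>= λ (t , s′ , b) →
    inj₂ (t , subst (λ w → State w u (S + w)) (first t)
                (subst (λ S → State (n₁ + k + t * u) u (S + (n₁ + k + t * u))) (sym S≡) s′)
            , subst₂ (λ a b → P * a ≤ Q * b) (second t) (sym S≡) b)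
    where
    open State s
    rearrange : ∀ u v a → u + v + a ≡ (u + a) + v
    rearrange = solve-∀
    rearrange′ : ∀ u v a → u + v + (u + a) ≡ (u + a) + v + u
    rearrange′ = solve-∀
    first : ∀ t → n₁ + k + t * u ≡ suc t * u + v
    first t = trans (cong (_+ t * u) (sym u+v)) (rearrange u v (t * u))
    second : ∀ t → n₁ + k + suc t * u ≡ (suc t * u + v) + u
    second t = trans (cong (_+ suc t * u) (sym u+v)) (rearrange′ u v (t * u))

  initial-state : D ⊎ (∃₂ λ u v → ∃ λ S → State u v S)
  initial-state with first-rep {n₀} ≤-refl
  ... | _ , _ , r , _ = next-jump ≤-refl r >>= λ (_ , _ , _ , _ , _ , s , _) → start s
    where
    from-zero : Jump n 0 → D ⊎ (∃₂ λ u v → ∃ λ S → State u v S)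
    from-zero s = next s >>= λ where
      (N , zero  , A) → next (Near.target A) >>= λ (_ , _ , B) → ⊥-elim (not-twice-at-start A B)
      -- J₀ - u need not be positive yet; after one `advance` the new `v` is the present u, which
      -- is.
      (N , suc l , A) → advance A (ℕ.m∸n+n≡m (<⇒≤ (Near.T.i<j A))) >>= λ (_ , s′ , _) →
        inj₂ (_ , _ , _ , s′)
    start : ∀ {n i} → Jump n i → D ⊎ (∃₂ λ u v → ∃ λ S → State u v S)
    start {i = zero}  s = from-zero s
    start {i = suc i} s = next s >>= λ (N , i′ , A) → recurs (Near.n₀≤N A) >>= λ rec →
      from-zero (subst (Jump (suc N)) (Near.returns-to-start A (s≤s z≤n) rec) (Near.target A))

-- Quotient patterns excluded by the ratio bound

module _ (u v S : ℕ) where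

  -- Here and in the next three lemmas the two ratio bounds are weighted so that `S` cancels. In
  -- `no-two-after-two` the state is the one between the two steps, otherwise the one before the
  -- first.
  no-quotient-≥3 : ∀ t → 0 < u → v ≤ u → 33 * S ≤ 50 * (u + v) →
    33 * ((suc (suc (suc t)) * u + v) + u) ≤ 50 * S → ⊥
  no-quotient-≥3 t 0<u v≤u a b = refute (33 ⊗ b ⊕ 50 ⊗ a ⊕ 1411 ⊗ v≤u) (identity t u v S)
    (≤-trans 0<u (ℕ.m≤m+n u _))
    where
    identity : ∀ t u v S →
      33 * (33 * ((suc (suc (suc t)) * u + v) + u)) + (50 * (33 * S) + 1411 * v)
      ≡ 33 * (50 * S) + (50 * (50 * (u + v)) + 1411 * u) + (u + (444 * u + 1089 * (t * u)))
    identity = solve-∀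

  no-two-after-two : 0 < v → 2 * v ≤ u → 33 * S ≤ 50 * (u + v) → 33 * (3 * u + v) ≤ 50 * S → ⊥
  no-two-after-two 0<v 2v≤u a b = refute (33 ⊗ b ⊕ 50 ⊗ a ⊕ 767 ⊗ 2v≤u) (identity u v S)
    (≤-trans 0<v (ℕ.m≤m+n v _))
    where
    identity : ∀ u v S → 33 * (33 * (3 * u + v)) + (50 * (33 * S) + 767 * (2 * v))
      ≡ 33 * (50 * S) + (50 * (50 * (u + v)) + 767 * u) + (v + 122 * v)
    identity = solve-∀

  no-two-one-two : 0 < v → 4 * v ≤ 3 * u → 33 * S ≤ 50 * (u + v) →
    33 * (3 * (3 * u + v) + (2 * u + v)) ≤ 50 * (S + (5 * u + 2 * v)) → ⊥
  no-two-one-two 0<v 4v≤3u a b = refute (99 ⊗ b ⊕ 150 ⊗ a ⊕ 1229 ⊗ 4v≤3u) (identity u v S)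
    (≤-trans 0<v (ℕ.m≤m+n v _))
    where
    identity : ∀ u v S →
      99 * (33 * (3 * (3 * u + v) + (2 * u + v))) + (150 * (33 * S) + 1229 * (4 * v))
      ≡ 99 * (50 * (S + (5 * u + 2 * v))) + (150 * (50 * (u + v)) + 1229 * (3 * u)) + (v + 583 * v)
    identity = solve-∀

  no-two-one-one-one : 0 < u → 33 * (3 * u + v) ≤ 50 * S →
    33 * (S + (18 * u + 7 * v)) ≤ 50 * ((8 * u + 3 * v) + (5 * u + 2 * v)) → ⊥
  no-two-one-one-one 0<u a b = refute (33 ⊗ a ⊕ 50 ⊗ b) (identity u v S)
    (≤-trans 0<u (ℕ.m≤m+n u _))
    where
    identity : ∀ u v S → 33 * (33 * (3 * u + v)) + 50 * (33 * (S + (18 * u + 7 * v)))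
      ≡ 33 * (50 * S) + 50 * (50 * ((8 * u + 3 * v) + (5 * u + 2 * v))) + (u + (466 * u + 139 * v))
    identity = solve-∀

-- Slopes beyond √10 - 5/2

-- Δ below is (2a + 3b)² > 40b² for q = b and e = 2a - 3b, so that (q + e) / 2q = a/b - 1.
module Slope {q e : ℕ} (Δ : 4 * (q * q) < e * e + 12 * (q * e)) where

  -- `Δ` puts e/q above 2√10 - 6 = 0.324..., the positive root of ξ² + 12ξ = 4; the fraction 8/25 is
  -- just below it.
  8q≤25e : 8 * q ≤ 25 * e
  8q≤25e with 8 * q ℕ.≤? 25 * e
  ... | yes p = p
  ... | no ¬p = ⊥-elim (refute
      (625 ⊗ Δ ⊕ ℕ.*-mono-≤ lt lt ⊕ (300 * q) ⊗ lt) (identity q e) (s≤s z≤n))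
    where
    lt : 25 * e ≤ 8 * q
    lt = <⇒≤ (ℕ.≰⇒> ¬p)
    identity : ∀ q e → 625 * (1 + 4 * (q * q)) + ((25 * e) * (25 * e) + (300 * q) * (25 * e))
      ≡ 625 * (e * e + 12 * (q * e)) + ((8 * q) * (8 * q) + (300 * q) * (8 * q)) + (625 + 36 * (q * q))
    identity = solve-∀

  -- 33/50 is slightly smaller than √10 - 5/2.
  ratio : 0 < q → ∀ {X Y} → (q + e) * X ≤ (2 * q) * Y → 33 * X ≤ 50 * Y
  ratio 0<q {X} {Y} b = ℕ.*-cancelˡ-≤ (2 * q) {{>-nonZero (≤-trans 0<q (ℕ.m≤m+n q _))}}
    (derive 0 (50 ⊗ b ⊕ (2 * X) ⊗ 8q≤25e) (identity q e X Y))
    where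
    identity : ∀ q e X Y → (2 * q) * (33 * X) + (50 * ((2 * q) * Y) + (2 * X) * (25 * e)) + 0
      ≡ (2 * q) * (50 * Y) + (50 * ((q + e) * X) + (2 * X) * (8 * q))
    identity = solve-∀

  -- The two roots of 3ξ² = 4ξ + 2 are the slopes of the eigenvectors of the cycle
  -- (u, v) ↦ (5u + 2v, 3u + v); on a hyperbola |3u² - 4uv - 2v²| ≤ Q₀ the bound on S
  -- can only hold for small v.
  cycle-bound : ∀ {u v S K Q₀} → (q + e) * S ≤ (2 * q) * (u + v) → 6 * u + 2 * v ≤ 3 * S + K →
    4 * v ≤ 3 * u → 4 * (u * v) + 2 * (v * v) ≤ 3 * (u * u) + Q₀ →
    let M = (q + e) * K in v * v ≤ 4 * (q * M) * v + (M * M + 3 * (e * e) * Q₀)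
  cycle-bound {u} {v} {S} {K} {Q₀} b inv 4v≤3u hyp = derive 0
      ((v * v) ⊗ Δ ⊕ ℕ.≤-trans main (ℕ.≤-reflexive (cong (_+ 3 * (e * e) * Q₀) (sym square))))
      (identity₄ q e v M (3 * (e * e) * Q₀))
    where
    M = (q + e) * K
    -- Up to `M` this bounds u/v by (2q/e - 1)/3, which `Δ` puts below the root (2 + √10)/3, whereas
    -- `hyp` keeps u/v above that root up to `Q₀`.
    linear : 3 * (e * u) + e * v ≤ 2 * (q * v) + M
    linear = ℕ.*-cancelˡ-≤ 2 (derive ((q + e) * K) (3 ⊗ b ⊕ (q + e) ⊗ inv) (identity₁ q e u v S K))
      where
      identity₁ : ∀ q e u v S K →
        2 * (3 * (e * u) + e * v) + (3 * ((2 * q) * (u + v)) + (q + e) * (3 * S + K)) + (q + e) * K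
        ≡ 2 * (2 * (q * v) + (q + e) * K) + (3 * ((q + e) * S) + (q + e) * (6 * u + 2 * v))
      identity₁ = solve-∀
    g = (2 * (q * v) + M) ∸ (3 * (e * u) + e * v)
    exact : 3 * (e * u) + e * v + g ≡ 2 * (q * v) + M
    exact = ℕ.m+[n∸m]≡n linear
    square : (2 * (q * v) + M) * (2 * (q * v) + M) ≡ (3 * (e * u) + e * v + g) * (3 * (e * u) + e * v + g)
    square = cong (λ z → z * z) (sym exact)
    main : (e * e + 12 * (q * e)) * (v * v) ≤
           (3 * (e * u) + e * v + g) * (3 * (e * u) + e * v + g) + 3 * (e * e) * Q₀
    main = derive (g * g + 4 * (g * (e * v)) + 6 * (e * v) * M)
      ((3 * (e * e)) ⊗ hyp ⊕ (2 * (g * e)) ⊗ 4v≤3u ⊕ ℕ.≤-reflexive (cong (6 * (e * v) *_) (sym exact)))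
      (identity₃ q e u v g M Q₀)
      where
      identity₃ : ∀ q e u v g M Q₀ →
        (e * e + 12 * (q * e)) * (v * v)
          + (3 * (e * e) * (3 * (u * u) + Q₀) + (2 * (g * e) * (3 * u) + 6 * (e * v) * (3 * (e * u) + e * v + g)))
          + (g * g + 4 * (g * (e * v)) + 6 * (e * v) * M)
        ≡ (3 * (e * u) + e * v + g) * (3 * (e * u) + e * v + g) + 3 * (e * e) * Q₀
          + (3 * (e * e) * (4 * (u * v) + 2 * (v * v)) + (2 * (g * e) * (4 * v) + 6 * (e * v) * (2 * (q * v) + M)))
      identity₃ = solve-∀
    identity₄ : ∀ q e v M w →
      v * v + ((v * v) * (e * e + 12 * (q * e)) + ((2 * (q * v) + M) * (2 * (q * v) + M) + w)) + 0
      ≡ 4 * (q * M) * v + (M * M + w) + ((v * v) * (1 + 4 * (q * q)) + (e * e + 12 * (q * e)) * (v * v))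
    identity₄ = solve-∀

-- Orbits of the continued fraction step

module Orbit {q e : ℕ} (0<q : 0 < q) (Δ : 4 * (q * q) < e * e + 12 * (q * e))
  (D : Set) (State : ℕ → ℕ → ℕ → Set)
  (0<u     : ∀ {u v S} → State u v S → 0 < u)
  (0<v     : ∀ {u v S} → State u v S → 0 < v)
  (S-bound : ∀ {u v S} → State u v S → (q + e) * S ≤ (2 * q) * (u + v))
  (step    : ∀ {u v S} → State u v S → D ⊎ (∃ λ t →
    State (suc t * u + v) u (S + (suc t * u + v)) × (q + e) * ((suc t * u + v) + u) ≤ (2 * q) * S))
  where

  open Slope {q} {e} Δ

  private
    cast : ∀ {u v S u′ v′ S′} → u ≡ u′ → v ≡ v′ → S ≡ S′ → State u v S → State u′ v′ S′
    cast refl refl refl s = s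

    S-bound′ : ∀ {u v S} → State u v S → 33 * S ≤ 50 * (u + v)
    S-bound′ s = ratio 0<q (S-bound s)

  One : ℕ → ℕ → ℕ → Set
  One u v S = State (u + v) u (S + (u + v))

  Two : ℕ → ℕ → ℕ → Set
  Two u v S = State (2 * u + v) u (S + (2 * u + v)) × 33 * (3 * u + v) ≤ 50 * S

  one-or-two : ∀ {u v S} → v ≤ u → State u v S → D ⊎ (One u v S ⊎ Two u v S)
  one-or-two {u} {v} {S} v≤u s with step s
  ... | inj₁ done = inj₁ done
  ... | inj₂ (zero , s′ , _) =
    inj₂ (inj₁ (subst (λ w → State (w + v) u (S + (w + v))) (+-identityʳ u) s′))
  ... | inj₂ (suc zero , s′ , b) = inj₂ (inj₂ (s′ ,
          subst (λ w → 33 * w ≤ 50 * S) (sum u v) (ratio 0<q b)))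
    where
    sum : ∀ u v → (2 * u + v) + u ≡ 3 * u + v
    sum = solve-∀
  ... | inj₂ (suc (suc t) , s′ , b) =
    ⊥-elim (no-quotient-≥3 u v S t (0<u s) v≤u (S-bound′ s) (ratio 0<q b))

  private
    after-two-one : ∀ u v S → One (2 * u + v) u (S + (2 * u + v)) →
                    State (3 * u + v) (2 * u + v) (S + (5 * u + 2 * v))
    after-two-one u v S = cast (eq₁ u v) refl (eq₂ u v S)
      where
      eq₁ : ∀ u v → 2 * u + v + u ≡ 3 * u + v
      eq₁ = solve-∀
      eq₂ : ∀ u v S → S + (2 * u + v) + (2 * u + v + u) ≡ S + (5 * u + 2 * v)
      eq₂ = solve-∀

    after-two-one-one : ∀ u v S → One (3 * u + v) (2 * u + v) (S + (5 * u + 2 * v)) →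
                        State (5 * u + 2 * v) (3 * u + v) (S + (10 * u + 4 * v))
    after-two-one-one u v S = cast (eq₁ u v) refl (eq₂ u v S)
      where
      eq₁ : ∀ u v → (3 * u + v) + (2 * u + v) ≡ 5 * u + 2 * v
      eq₁ = solve-∀
      eq₂ : ∀ u v S → S + (5 * u + 2 * v) + ((3 * u + v) + (2 * u + v)) ≡ S + (10 * u + 4 * v)
      eq₂ = solve-∀

    after-two-one-one-one : ∀ u v S → One (5 * u + 2 * v) (3 * u + v) (S + (10 * u + 4 * v)) →
                            State (8 * u + 3 * v) (5 * u + 2 * v) (S + (18 * u + 7 * v))
    after-two-one-one-one u v S = cast (eq₁ u v) refl (eq₂ u v S)
      where
      eq₁ : ∀ u v → (5 * u + 2 * v) + (3 * u + v) ≡ 8 * u + 3 * v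
      eq₁ = solve-∀
      eq₂ : ∀ u v S → S + (10 * u + 4 * v) + ((5 * u + 2 * v) + (3 * u + v)) ≡ S + (18 * u + 7 * v)
      eq₂ = solve-∀

    u≤2u+v : ∀ u v → u ≤ 2 * u + v
    u≤2u+v u v = ≤-trans (ℕ.m≤m+n u _) (ℕ.m≤m+n (2 * u) v)

  -- After a 2 the quotients 1, 1, 2 are forced: a second 2 is excluded at once and after a single
  -- 1, and so is a third 1. The steps 2, 1, 1 compose to (u, v) ↦ (5u + 2v, 3u + v).
  cycle : ∀ {u v S} → 4 * v ≤ 3 * u → State u v S → Two u v S →
    let u′ = 5 * u + 2 * v; v′ = 3 * u + v; S′ = S + (10 * u + 4 * v) in
    D ⊎ (State u′ v′ S′ × Two u′ v′ S′)
  cycle {u} {v} {S} 4v≤3u s (s₁ , b) with one-or-two (u≤2u+v u v) s₁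
  ... | inj₁ done = inj₁ done
  ... | inj₂ (inj₂ (_ , b₁)) = ⊥-elim (no-two-after-two (2 * u + v) u (S + (2 * u + v))
          (0<v s₁) (ℕ.m≤m+n (2 * u) v) (S-bound′ s₁) b₁)
  ... | inj₂ (inj₁ s₂) with one-or-two (ℕ.+-monoˡ-≤ v (ℕ.*-monoˡ-≤ u {2} {3} (s≤s (s≤s z≤n))))
                                       (after-two-one u v S s₂)
  ...   | inj₁ done = inj₁ done
  ...   | inj₂ (inj₂ (_ , b₂)) = ⊥-elim (no-two-one-two u v S (0<v s) 4v≤3u (S-bound′ s) b₂)
  ...   | inj₂ (inj₁ s₃) with one-or-two (derive (2 * u + v) (z≤n {0}) (slack u v)) (after-two-one-one u v S s₃)
    where
    slack : ∀ u v → 3 * u + v + 0 + (2 * u + v) ≡ 5 * u + 2 * v + 0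
    slack = solve-∀
  ...     | inj₁ done = inj₁ done
  ...     | inj₂ (inj₂ two) = inj₂ (after-two-one-one u v S s₃ , two)
  ...     | inj₂ (inj₁ s₄) = ⊥-elim (no-two-one-one-one u v S (0<u s) b
              (S-bound′ (after-two-one-one-one u v S s₄)))

  -- K and Q₀ bound quantities that are constant along the cycle (3S - 6u - 2v) or
  -- change sign only (3u² - 4uv - 2v²).
  iterate-cycle : ∀ K Q₀ f {u v S} → 4 * v ≤ 3 * u → State u v S → Two u v S →
    6 * u + 2 * v ≤ 3 * S + K →
    4 * (u * v) + 2 * (v * v) ≤ 3 * (u * u) + Q₀ →
    3 * (u * u) ≤ 4 * (u * v) + 2 * (v * v) + Q₀ →
    (let M = (q + e) * K in 4 * (q * M) + (M * M + 3 * (e * e) * Q₀) < v + f) → D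
  iterate-cycle K Q₀ zero {u} {v} {S} 4v≤3u s two inv h₁ _ large =
    ⊥-elim (ℕ.<⇒≱ too-large (cycle-bound {u} {v} {S} {K} {Q₀} (S-bound s) inv 4v≤3u h₁))
    where
    M = (q + e) * K
    A = 4 * (q * M)
    B = M * M + 3 * (e * e) * Q₀
    A+B<v : A + B < v
    A+B<v = subst (A + B <_) (+-identityʳ v) large
    too-large : A * v + B < v * v
    too-large = ≤-<-trans
      (ℕ.+-monoʳ-≤ (A * v) (≤-trans (ℕ.≤-reflexive (sym (ℕ.*-identityʳ B))) (ℕ.*-monoʳ-≤ B (0<v s))))
      (subst (_< v * v) (ℕ.*-distribʳ-+ v A B)
        (ℕ.*-monoˡ-< v {{>-nonZero (0<v s)}} A+B<v))
  iterate-cycle K Q₀ (suc f) {u} {v} {S} 4v≤3u s two inv h₁ h₂ large with cycle 4v≤3u s two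
  ... | inj₁ done = done
  ... | inj₂ (s′ , two′) = iterate-cycle K Q₀ f
      (derive (3 * u + 2 * v) (z≤n {0}) (id₁ u v)) s′ two′
      (derive 0 inv (id₂ u v S K))
      (derive 0 h₂ (id₃ u v Q₀)) (derive 0 h₁ (id₄ u v Q₀))
      -- The new v exceeds the old one by 3u > 0, which pays for the unit of `f`.
      (<-≤-trans large (≤-trans (ℕ.≤-reflexive (+-suc v f)) (ℕ.+-monoˡ-≤ f
        (ℕ.+-mono-≤ (≤-trans (0<u s) (ℕ.m≤m+n u _)) (≤-refl {v})))))
    where
    id₁ : ∀ u v → 4 * (3 * u + v) + 0 + (3 * u + 2 * v) ≡ 3 * (5 * u + 2 * v) + 0
    id₁ = solve-∀
    id₂ : ∀ u v S K → 6 * (5 * u + 2 * v) + 2 * (3 * u + v) + (3 * S + K) + 0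
      ≡ 3 * (S + (10 * u + 4 * v)) + K + (6 * u + 2 * v)
    id₂ = solve-∀
    id₃ : ∀ u v Q₀ → let u′ = 5 * u + 2 * v; v′ = 3 * u + v in
      4 * (u′ * v′) + 2 * (v′ * v′) + (4 * (u * v) + 2 * (v * v) + Q₀) + 0
      ≡ 3 * (u′ * u′) + Q₀ + 3 * (u * u)
    id₃ = solve-∀
    id₄ : ∀ u v Q₀ → let u′ = 5 * u + 2 * v; v′ = 3 * u + v in
      3 * (u′ * u′) + (3 * (u * u) + Q₀) + 0
      ≡ 4 * (u′ * v′) + 2 * (v′ * v′) + Q₀ + (4 * (u * v) + 2 * (v * v))
    id₄ = solve-∀

  run-cycle : ∀ {u v S} → 4 * v ≤ 3 * u → State u v S → Two u v S → D
  run-cycle {u} {v} {S} 4v≤3u s two =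
    iterate-cycle K Q₀ (suc (4 * (q * M) + (M * M + 3 * (e * e) * Q₀))) 4v≤3u s two
      (ℕ.m≤n+m K (3 * S))
      (derive (3 * (u * u) + 3 * (u * u)) (z≤n {0}) (id₁ u v))
      (derive (4 * (u * v) + 2 * (v * v) + (4 * (u * v) + 2 * (v * v))) (z≤n {0}) (id₂ u v))
      (ℕ.m≤n+m _ v)
    where
    -- Chosen large enough for all three invariants to hold at the start.
    K  = 6 * u + 2 * v
    Q₀ = 3 * (u * u) + 4 * (u * v) + 2 * (v * v)
    M  = (q + e) * K
    id₁ : ∀ u v → 4 * (u * v) + 2 * (v * v) + 0 + (3 * (u * u) + 3 * (u * u))
      ≡ 3 * (u * u) + (3 * (u * u) + 4 * (u * v) + 2 * (v * v)) + 0
    id₁ = solve-∀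
    id₂ : ∀ u v → 3 * (u * u) + 0 + (4 * (u * v) + 2 * (v * v) + (4 * (u * v) + 2 * (v * v)))
      ≡ 4 * (u * v) + 2 * (v * v) + (3 * (u * u) + 4 * (u * v) + 2 * (v * v)) + 0
    id₂ = solve-∀

  private
    one-≤3 : ∀ {u v} → v ≤ u → u + v ≤ 3 * u
    one-≤3 {u} {v} v≤u = derive u v≤u (identity u v)
      where
      identity : ∀ u v → u + v + u + u ≡ 3 * u + v
      identity = solve-∀

    two-≤3 : ∀ {u v} → v ≤ u → 2 * u + v ≤ 3 * u
    two-≤3 {u} {v} v≤u = derive 0 v≤u (identity u v)
      where
      identity : ∀ u v → 2 * u + v + u + 0 ≡ 3 * u + v
      identity = solve-∀

    one-≥4/3 : ∀ {u v} → u ≤ 3 * v → 4 * u ≤ 3 * (u + v)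
    one-≥4/3 {u} {v} u≤3v = derive 0 u≤3v (identity u v)
      where
      identity : ∀ u v → 4 * u + 3 * v + 0 ≡ 3 * (u + v) + u
      identity = solve-∀

    two-≥4/3 : ∀ u v → 4 * u ≤ 3 * (2 * u + v)
    two-≥4/3 u v = derive (2 * u + 3 * v) (z≤n {0}) (identity u v)
      where
      identity : ∀ u v → 4 * u + 0 + (2 * u + 3 * v) ≡ 3 * (2 * u + v) + 0
      identity = solve-∀

    ≥4/3⇒> : ∀ {u v} → 0 < v → 4 * v ≤ 3 * u → v < u
    ≥4/3⇒> {u} {v} 0<v 4v≤3u = ℕ.*-cancelˡ-< 3 v u (<-≤-trans
      (ℕ.*-monoˡ-< v {{>-nonZero 0<v}} {3} {4} (s≤s (s≤s (s≤s (s≤s z≤n))))) 4v≤3u)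

  -- S - 2u - v is constant along a run of ones, while u / v tends to the golden
  -- ratio, so that 33 S ≤ 50 (u + v) fails eventually.
  reach-two : ∀ K f {u v S} → 4 * v ≤ 3 * u → u ≤ 3 * v → State u v S →
    2 * u + v ≤ S + K → 8 * K < v + f → D
  reach-two K zero {u} {v} {S} 4v≤3u u≤3v s inv large =
    ⊥-elim (refute (99 ⊗ inv ⊕ 3 ⊗ S-bound′ s ⊕ 16 ⊗ 4v≤3u ⊕ 13 ⊗ large) (identity u v S K) (s≤s z≤n))
    where
    identity : ∀ u v S K →
      99 * (2 * u + v) + (3 * (33 * S) + (16 * (4 * v) + 13 * (1 + 8 * K)))
      ≡ 99 * (S + K) + (3 * (50 * (u + v)) + (16 * (3 * u) + 13 * (v + 0))) + (13 + 5 * K)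
    identity = solve-∀
  reach-two K (suc f) {u} {v} {S} 4v≤3u u≤3v s inv large
    with one-or-two (<⇒≤ (≥4/3⇒> (0<v s) 4v≤3u)) s
  ... | inj₁ done = done
  ... | inj₂ (inj₂ two) = run-cycle 4v≤3u s two
  ... | inj₂ (inj₁ s′) = reach-two K f
      (one-≥4/3 u≤3v) (one-≤3 (<⇒≤ v<u)) s′ (derive 0 inv (identity u v S K))
      (<-≤-trans large (≤-trans (ℕ.≤-reflexive (+-suc v f)) (ℕ.+-monoˡ-≤ f v<u)))
    where
    v<u : v < u
    v<u = ≥4/3⇒> (0<v s) 4v≤3u
    identity : ∀ u v S K → 2 * (u + v) + u + (S + K) + 0 ≡ S + (u + v) + K + (2 * u + v)
    identity = solve-∀

  -- The first quotient is arbitrary but gives v ≤ u; two more, each 1 or 2, bring u/v between 4/3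
  -- and 3.
  orbit-ends : ∀ {u v S} → State u v S → D
  orbit-ends {u} {v} s with step s
  ... | inj₁ done = done
  ... | inj₂ (t , s₁ , _) = second (≤-trans (ℕ.m≤m+n u (t * u)) (ℕ.m≤m+n (suc t * u) v)) s₁
    where
    fourth : ∀ {u v S} → 4 * v ≤ 3 * u → u ≤ 3 * v → State u v S → D
    fourth {u} {v} {S} 4v≤3u u≤3v s = reach-two (2 * u + v) (suc (8 * (2 * u + v))) 4v≤3u u≤3v s
      (ℕ.m≤n+m _ S) (ℕ.m≤n+m _ v)
    third : ∀ {u v S} → v ≤ u → u ≤ 3 * v → State u v S → D
    third {u} {v} v≤u u≤3v s with one-or-two v≤u s
    ... | inj₁ done            = done
    ... | inj₂ (inj₁ s′)       = fourth (one-≥4/3 u≤3v) (one-≤3 v≤u) s′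
    ... | inj₂ (inj₂ (s′ , _)) = fourth (two-≥4/3 u v) (two-≤3 v≤u) s′
    second : ∀ {u v S} → v ≤ u → State u v S → D
    second {u} {v} v≤u s with one-or-two v≤u s
    ... | inj₁ done            = done
    ... | inj₂ (inj₁ s′)       = third (ℕ.m≤m+n u v) (one-≤3 v≤u) s′
    ... | inj₂ (inj₂ (s′ , _)) = third (u≤2u+v u v) (two-≤3 v≤u) s′

-- Repetitions, absorption of constants and induction on k

agree⇒RepAt : {x : Word d} → i < j → Agree x n i j → RepAt x n (j + n)
agree⇒RepAt {i = i} {j} {n} {x} i<j p = i , ℕ.+-monoˡ-< n i<j , λ t →
  trans (letters p (Fin.toℕ<n t)) (cong (λ s → x (s + toℕ t)) (sym (ℕ.m+n∸n≡m j n)))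

RepAt-shift : (x : Word d) → RepAt (x ∘ suc) n m → RepAt x n (suc m)
RepAt-shift {n = n} {m} x (j , j+n<m , p) = suc j , s<s j+n<m , λ t →
  trans (p t) (cong (λ s → x (s + toℕ t)) (sym (ℕ.+-∸-assoc 1 (≤-trans (ℕ.m≤n+m n j) (<⇒≤ j+n<m)))))

repAt? : (x : Word d) → ∀ n m → Dec (RepAt x n m)
repAt? x n m = map′ (λ (j , _ , r) → j , r) (λ (j , <m , p) → j , ≤-<-trans (ℕ.m≤m+n j n) <m , <m , p)
  (anyUpTo? (λ j → (j + n ℕ.<? m) ×-dec Fin.all? (λ t → x (j + toℕ t) Fin.≟ x ((m ∸ n) + toℕ t))) m)

RepAt⇒IsR : (x : Word d) → RepAt x n m → ∃ λ r → r ≤ m × IsR x n r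
RepAt⇒IsR {n = n} x = go _ ≤-refl
  where
  go : ∀ f {m} → m ≤ f → RepAt x n m → ∃ λ r → r ≤ m × IsR x n r
  go f {m} m≤f r@(_ , <m , _) with anyUpTo? (repAt? x n) m
  go f       {m} m≤f r@(_ , <m , _) | no ∄ = m , ≤-refl , ≤-<-trans z≤n <m , r , λ m′ _ m′<m r′ → ∄ (m′ , m′<m , r′)
  go zero    {m} m≤0 _ | yes (m′ , m′<m , _) = contradiction (<-≤-trans m′<m m≤0) λ ()
  go (suc f) {m} m≤f _ | yes (m′ , m′<m , r′) with go f (ℕ.≤-pred (<-≤-trans m′<m m≤f)) r′
  ... | r , r≤m′ , isR = r , ≤-trans r≤m′ (<⇒≤ m′<m) , isR

-- `c` counts the letters removed from the front: a repetition in the rest ends that much later in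
-- the whole word.
ShortRep : Word d → (a b c N : ℕ) → Set
ShortRep x a b c N = ∃ λ n → ∃ λ m → N ≤ n × RepAt x n m × b * (m + c) < a * n

-- For a/b = 1 + (q₀ + e₀) / 2q₀ beyond √10 - 3/2, a slope 1 + (q + e) / 2q in between
-- absorbs the additive constants.
record Slack (a b : ℕ) : Set where
  field
    {q e}  : ℕ
    0<q    : 0 < q
    Δ      : 4 * (q * q) < e * e + 12 * (q * e)
    absorb : ∀ k c → ∃ λ T → ∀ {n j} → T ≤ n → a * n ≤ b * (j + n + c) →
             (q + e) * (suc n + k) ≤ (2 * q) * j

module _ (q e τ : ℕ) {q′ e′ : ℕ} (q′≡ : q′ ≡ τ * q) (1+e′≡ : suc e′ ≡ τ * e) where

  -- Scaling by τ turns the gap 1 of `Δ` into τ²; lowering τe by one costs 2τe + 12τq - 1 = τ² - 1.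
  slope-between : τ ≡ 2 * e + 12 * q → 4 * (q * q) < e * e + 12 * (q * e) →
    4 * (q′ * q′) < e′ * e′ + 12 * (q′ * e′)
  slope-between τ≡ Δ = derive 0 scaled (shifted q′ e′)
    where
    left : ∀ τ q e → (τ * τ) * (4 * (q * q)) + τ * (2 * e + 12 * q)
      ≡ 2 * (τ * e) + 12 * (τ * q) + 4 * ((τ * q) * (τ * q))
    left = solve-∀
    left′ : ∀ τ t → (τ * τ) * suc t ≡ (τ * τ) * t + τ * τ
    left′ = solve-∀
    right : ∀ τ q e →
      (τ * τ) * (e * e + 12 * (q * e)) ≡ (τ * e) * (τ * e) + 12 * ((τ * q) * (τ * e))
    right = solve-∀
    shifted : ∀ q e → 1 + 4 * (q * q) + (suc e * suc e + 12 * (q * suc e)) + 0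
      ≡ e * e + 12 * (q * e) + (2 * suc e + 12 * q + 4 * (q * q))
    shifted = solve-∀
    Claim : ℕ → ℕ → Set
    Claim q E = 2 * E + 12 * q + 4 * (q * q) ≤ E * E + 12 * (q * E)
    scaled : Claim q′ (suc e′)
    scaled = subst₂ Claim (sym q′≡) (sym 1+e′≡)
      (subst₂ _≤_
        (trans (left′ τ (4 * (q * q)))
          (trans (cong (λ t → (τ * τ) * (4 * (q * q)) + τ * t) τ≡) (left τ q e)))
        (right τ q e) ((τ * τ) ⊗ Δ))

  -- Lowering τe by one frees a summand `n`, which by `large` covers the terms in `c` and `k`.
  absorb-constants : ∀ {a} → 3 * q + e ≡ 2 * a → ∀ k c {n j} →
    τ * (2 * (q * c) + (q + e) * suc k) ≤ n → a * n ≤ q * (j + n + c) →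
    (q′ + e′) * (suc n + k) ≤ (2 * q′) * j
  absorb-constants {a} 2a≡ k c {n} {j} large long = subst
    (λ q′ → (q′ + e′) * (suc n + k) ≤ (2 * q′) * j) (sym q′≡) (derive (suc k)
    ((2 * τ) ⊗ long ⊕ (τ * n) ⊗ ℕ.≤-reflexive 2a≡ ⊕ (suc n + k) ⊗ ℕ.≤-reflexive 1+e′≡ ⊕ large)
    (identity τ q e e′ a k c n j))
    where
    identity : ∀ τ q e e′ a k c n j →
      (τ * q + e′) * (suc n + k)
        + (2 * τ * (q * (j + n + c)) + (τ * n * (2 * a) + ((suc n + k) * (τ * e) + n))) + suc k
      ≡ 2 * (τ * q) * j + (2 * τ * (a * n) + (τ * n * (3 * q + e)
        + ((suc n + k) * suc e′ + τ * (2 * (q * c) + (q + e) * suc k))))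
    identity = solve-∀

slack : ∀ {a b} → 0 < b → 40 * (b * b) < (2 * a + 3 * b) * (2 * a + 3 * b) → Slack a b
slack {a} {b} 0<b H = record
  { q      = τ * b
  ; e      = pred (τ * e)
  ; 0<q    = ℕ.*-mono-≤ 0<τ 0<b
  ; Δ      = slope-between b e τ refl 1+e′≡ refl Δ
  ; absorb = λ k c → _ , absorb-constants b e τ refl 1+e′≡ {a} 2a≡ k c
  }
  where
  3b≤2a : 3 * b ≤ 2 * a
  3b≤2a with 3 * b ℕ.≤? 2 * a
  ... | yes p = p
  ... | no ¬p = ⊥-elim (refute (H ⊕ ℕ.*-mono-≤ le le) (identity a b) (s≤s z≤n))
    where
    le : 2 * a + 3 * b ≤ 3 * b + 3 * b
    le = ℕ.+-monoˡ-≤ (3 * b) (<⇒≤ (ℕ.≰⇒> ¬p))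
    identity : ∀ a b → 1 + 40 * (b * b) + (2 * a + 3 * b) * (2 * a + 3 * b)
      ≡ (2 * a + 3 * b) * (2 * a + 3 * b) + (3 * b + 3 * b) * (3 * b + 3 * b) + (1 + 4 * (b * b))
    identity = solve-∀

  e = 2 * a ∸ 3 * b
  τ = 2 * e + 12 * b

  2a≡ : 3 * b + e ≡ 2 * a
  2a≡ = ℕ.m+[n∸m]≡n 3b≤2a

  Δ : 4 * (b * b) < e * e + 12 * (b * e)
  Δ = derive 0 (subst (λ A → 40 * (b * b) < (A + 3 * b) * (A + 3 * b)) (sym 2a≡) H) (identity b e)
    where
    identity : ∀ b e → 1 + 4 * (b * b) + (3 * b + e + 3 * b) * (3 * b + e + 3 * b) + 0
      ≡ e * e + 12 * (b * e) + (1 + 40 * (b * b))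
    identity = solve-∀

  0<e : 0 < e
  0<e = go e Δ
    where
    go : ∀ e → 4 * (b * b) < e * e + 12 * (b * e) → 0 < e
    go zero    Δ₀ = contradiction (subst (4 * (b * b) <_) (cong (12 *_) (ℕ.*-zeroʳ b)) Δ₀) λ ()
    go (suc e) _  = z<s

  0<τ : 0 < τ
  0<τ = ≤-trans 0<b (≤-trans (ℕ.m≤m+n b _) (ℕ.m≤n+m (12 * b) (2 * e)))

  1+e′≡ : suc (pred (τ * e)) ≡ τ * e
  1+e′≡ = ℕ.suc-pred (τ * e) {{>-nonZero (ℕ.*-mono-≤ 0<τ 0<e)}}

module _ {a b : ℕ} (sl : Slack a b) where

  open Slack sl

  -- Induction on `k`: if some long prefix does not recur, removing the first letter lowers `k` by
  -- one. The value 0 is impossible, as a right special factor of length `n₀` forces more than `n₀`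
  -- factors.
  short-rep : ∀ k {n₀ d} {x : Word d} → (∀ {n} → n₀ ≤ n → Classes x n (n + k)) →
              ∀ c N → ShortRep x a b c N
  short-rep zero {n₀} {x = x} C c N = ⊥-elim (ℕ.<-irrefl (sym (+-identityʳ n₀)) n₀<n₀+0)
    where
    n₀<n₀+0 : n₀ < n₀ + 0
    n₀<n₀+0 with Level.right-special-exists (C ≤-refl) (C (ℕ.n≤1+n n₀))
    ... | i , j , p , break = complexity-lower-bound p break (C ≤-refl)
  short-rep (suc k) {n₀} {x = x} C c N = [ id , (λ (_ , _ , _ , s) → orbit-ends s) ]′ initial-state
    where
    T  = proj₁ (absorb (suc k) c)
    n₁ = n₀ + (N + T)
    D  = ShortRep x a b c N

    n₀≤_ : ∀ {n} → n₁ ≤ n → n₀ ≤ n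
    n₀≤ n₁≤n = ≤-trans (ℕ.m≤m+n n₀ _) n₁≤n
    N≤_ : ∀ {n} → n₁ ≤ n → N ≤ n
    N≤ n₁≤n = ≤-trans (≤-trans (ℕ.m≤m+n N _) (ℕ.m≤n+m _ n₀)) n₁≤n
    T≤_ : ∀ {n} → n₁ ≤ n → T ≤ n
    T≤ n₁≤n = ≤-trans (≤-trans (ℕ.m≤n+m _ N) (ℕ.m≤n+m _ n₀)) n₁≤n

    long : ∀ {n i j} → n₁ ≤ n → i < j → Agree x n i j → D ⊎ (q + e) * (suc n + suc k) ≤ (2 * q) * j
    long {n} {i} {j} n₁≤n i<j p with b * (j + n + c) ℕ.<? a * n
    ... | yes short = inj₁ (n , j + n , N≤ n₁≤n , agree⇒RepAt i<j p , short)
    ... | no ¬short = inj₂ (proj₂ (absorb (suc k) c) (T≤ n₁≤n) (ℕ.≮⇒≥ ¬short))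

    unshift : ShortRep (x ∘ suc) a b (suc c) N → D
    unshift (n , m , N≤n , r , short) = n , suc m , N≤n , RepAt-shift x r ,
      subst (λ s → b * s < a * n) (+-suc m c) short

    recurs : ∀ {n} → n₁ ≤ n → D ⊎ Recurs x n
    recurs {n} n₁≤n with Level.recurs? (C (n₀≤ n₁≤n)) (C (m≤n⇒m≤1+n (n₀≤ n₁≤n)))
    ... | yes r = inj₂ r
    ... | no ¬r = inj₁ (unshift (short-rep k shifted (suc c) N))
      where
      shifted : ∀ {n′} → n ≤ n′ → Classes (x ∘ suc) n′ (n′ + k)
      shifted {n′} n≤n′ = classes-shift
        (subst (Classes x n′) (+-suc n′ k) (C (≤-trans (n₀≤ n₁≤n) n≤n′)))
        λ (m , p) → ¬r (m , agree-mono n≤n′ p)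

    open Dynamics (λ n₁≤n → C (n₀≤ n₁≤n)) D (q + e) (2 * q) (≤-trans 0<q (ℕ.m≤m+n q e))
      long recurs (Slope.ratio {q} {e} Δ 0<q)
    open Orbit {q} {e} 0<q Δ D State State.0<u State.0<v State.S-bound step

theorem3p7 : (d : ℕ) (s : Word d) → QuasiSturmian s → RepLe√10-3/2 s
theorem3p7 d s (k , n₀ , _ , complexity) a b 1≤b H N =
  least (short-rep (slack {a} {b} 1≤b H) k {x = s} (λ {n} n₀≤n → classes (complexity n n₀≤n)) 0 N)
  where
  least : ShortRep s a b 0 N → ∃[ n ] ∃[ m ] ((N ≤ n) × IsR s n m × (b * m < a * n))
  least (n , m , N≤n , rep , short) =
    let r , r≤m , isR = RepAt⇒IsR s rep
    in n , r , N≤n , isR , ≤-<-trans (ℕ.*-monoʳ-≤ b (≤-trans r≤m (ℕ.m≤m+n m 0))) short
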